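{- Let $(\bar a_i)_{i\in I}$ and $(\bar b_j)_{j\in J}$ be sequences of indiscernibles. (1) The kernel is a $\approx$-invariant: if $(\bar a_i)_{i\in I}\approx(\bar b_j)_{j\in J}$, then $\ker(\bar a_i)_{i\in I}=\ker(\bar b_j)_{j\in J}$. (2) If $(\bar a_i)_{i\in I}$ and $(\bar b_j)_{j\in J}$ are cleanly collinear, then $\ker(\bar a_i)_{i\in I}=\operatorname{dcl}(\{\bar a_i\mid i\in I\})\cap\operatorname{dcl}(\{\bar b_j\mid j\in J\})$. (3) $\ker(\bar a_i)_{i\in I}=\operatorname{dcl}\ker(\bar a_i)_{i\in I}$. (4) $(\bar a_i)_{i\in I}$ is indiscernible over $\ker(\bar a_i)_{i\in I}$.
   Context: $T$ is a complete consistent first-order theory (possibly many-sorted); we work in a big saturated model of $T$, with definable closure $\operatorname{dcl}$. Tuples may be infinite, and $\operatorname{dcl}(\{\bar a_i\mid i\in I\})$ means the definable closure of the set of all entries of all tuples $\bar a_i$. Sequences of indiscernibles are indexed by arbitrary infinite (small) linearly ordered sets. The kernel of a sequence of indiscernibles $(\bar a_i)_{i\in I}$ is the set $$\ker(\bar a_i)_{i\in I}=\{d\mid d\in\operatorname{dcl}(\{\bar a_i\mid i\in I\})\text{ and }(\bar a_i)_{i\in I}\text{ is indiscernible over }d\}$$ (where $d$ ranges over single elements). Two sequences of indiscernibles $(\bar a_i)_{i\in I}$ and $(\bar b_j)_{j\in J}$ are cleanly collinear if one of their two concatenations (the sequence indexed by the disjoint union $I+J$ ordered so that $I<J$, or the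 one indexed by $J+I$ with $J<I$) is indiscernible. $\approx$ denotes the transitive closure of clean collinearity. -}

module Defs where

open import Level using (Level; _⊔_) renaming (suc to lsuc)
open import Data.Empty using (⊥)
open import Data.Fin using (Fin)
import Data.Fin as Fin
open import Data.List using (List; []; _∷_; _++_; map)
open import Data.List.Membership.Propositional using (_∈_; _∉_)
open import Data.List.Relation.Unary.All using (All; []; _∷_; lookup; universal)
open import Data.List.Relation.Unary.All.Properties using (map⁺; ++⁺)
open import Data.Product using (Σ; ∃; _×_; _,_; proj₁; proj₂)
open import Data.Sum using (_⊎_; [_,_])
open import Data.Sum.Relation.Binary.LeftOrder using (_⊎-<_)
open import Function using (_∘_; _↣_; _⇔_)
open import Relation.Binary.Core using (Rel; _Preserves_⟶_)
open import Relation.Binary.Construct.Closure.Transitive using (TransClosure)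
open import Relation.Binary.PropositionalEquality using (_≡_)
open import Relation.Binary.Structures using (IsStrictTotalOrder)
open import Relation.Nullary using (¬_)
open import Relation.Unary using (Pred; ∅; ｛_｝)

-- A single universe level ℓ carries languages, structures and index sets.
-- No classical axiom is built in: truth is given by Tarski's clauses in the
-- metatheory, so under excluded middle and choice every notion below is the
-- classical one.

record Language (ℓ : Level) : Set (lsuc ℓ) where
  field
    Sort : Set ℓ
    Fun  : List Sort → Sort → Set ℓ
    Rln  : List Sort → Set ℓ

module _ {ℓ : Level} (L : Language ℓ) where
  open Language L

  -- A context lists the sorts of the free variables (de Bruijn).
  data Term (Γ : List Sort) : Sort → Set ℓ where
    var : ∀ {s} → s ∈ Γ → Term Γ s
    fun : ∀ {Δ s} → Fun Δ s → All (Term Γ) Δ → Term Γ s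

  data Formula (Γ : List Sort) : Set ℓ where
    _≈ᶠ_            : ∀ {s} → Term Γ s → Term Γ s → Formula Γ
    rel             : ∀ {Δ} → Rln Δ → All (Term Γ) Δ → Formula Γ
    ⊥ᶠ              : Formula Γ
    _⇒ᶠ_ _∧ᶠ_ _∨ᶠ_  : Formula Γ → Formula Γ → Formula Γ
    ∀ᶠ ∃ᶠ           : (s : Sort) → Formula (s ∷ Γ) → Formula Γ

  Sentence : Set ℓ
  Sentence = Formula []

  Theory : Set (lsuc ℓ)
  Theory = Pred Sentence ℓ

  record Structure : Set (lsuc ℓ) where
    field
      Carrier  : Sort → Set ℓ
      nonempty : ∀ s → Carrier s
      ⟦fun⟧    : ∀ {Δ s} → Fun Δ s → All Carrier Δ → Carrier s
      ⟦rel⟧    : ∀ {Δ} → Rln Δ → All Carrier Δ → Set ℓ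

module _ {ℓ : Level} {L : Language ℓ} (M : Structure L) where
  open Language L
  open Structure M

  mutual
    eval : ∀ {Γ s} → All Carrier Γ → Term L Γ s → Carrier s
    eval ρ (var x)    = lookup ρ x
    eval ρ (fun f ts) = ⟦fun⟧ f (evals ρ ts)

    evals : ∀ {Γ Δ} → All Carrier Γ → All (Term L Γ) Δ → All Carrier Δ
    evals ρ []       = []
    evals ρ (t ∷ ts) = eval ρ t ∷ evals ρ ts

  Sat : ∀ {Γ} → All Carrier Γ → Formula L Γ → Set ℓ
  Sat ρ (t ≈ᶠ u)   = eval ρ t ≡ eval ρ u
  Sat ρ (rel R ts) = ⟦rel⟧ R (evals ρ ts)
  Sat ρ ⊥ᶠ         = Level.Lift ℓ ⊥
  Sat ρ (φ ⇒ᶠ ψ)   = Sat ρ φ → Sat ρ ψ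
  Sat ρ (φ ∧ᶠ ψ)   = Sat ρ φ × Sat ρ ψ
  Sat ρ (φ ∨ᶠ ψ)   = Sat ρ φ ⊎ Sat ρ ψ
  Sat ρ (∀ᶠ s φ)   = ∀ (d : Carrier s) → Sat (d ∷ ρ) φ
  Sat ρ (∃ᶠ s φ)   = Σ (Carrier s) λ d → Sat (d ∷ ρ) φ

  _⊨ₛ_ : Sentence L → Set ℓ
  _⊨ₛ_ φ = Sat [] φ

  IsModelOf : Theory L → Set ℓ
  IsModelOf T = ∀ {φ} → T φ → _⊨ₛ_ φ

  Element : Set ℓ
  Element = Σ Sort Carrier

  -- A tuple whose entries are indexed by an arbitrary type, with given sorts.
  Tuple : {X : Set ℓ} → (X → Sort) → Set ℓ
  Tuple σ = ∀ x → Carrier (σ x)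

  entries : {X : Set ℓ} {σ : X → Sort} → Tuple σ → Pred Element ℓ
  entries {σ = σ} c e = ∃ λ x → e ≡ (σ x , c x)

  restrict : {X : Set ℓ} {σ : X → Sort} → Tuple σ → (v : List X) → All Carrier (map σ v)
  restrict c v = map⁺ (universal c v)

  _⊆ₚ_ : ∀ {Γ b} → All Carrier Γ → Pred Element b → Set (ℓ ⊔ b)
  _⊆ₚ_ {Γ} ρ B = ∀ {s} (x : s ∈ Γ) → B (s , lookup ρ x)

  dcl : ∀ {b} → Pred Element b → Pred Element (ℓ ⊔ b)
  dcl B (s , d) =
    ∃ λ (Γ : List Sort) → Σ (All Carrier Γ) λ b → _⊆ₚ_ b B × Σ (Formula L (s ∷ Γ)) λ φ →
      Sat (d ∷ b) φ × (∀ e → Sat (e ∷ b) φ → e ≡ d)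

  -- Equality of types, tp(c/B) = tp(c′/B).  A formula mentions only finitely
  -- many entries of c, namely those listed in v, and finitely many parameters b.
  SameType : ∀ {b} {X : Set ℓ} {σ : X → Sort} → Pred Element b → Tuple σ → Tuple σ → Set (ℓ ⊔ b)
  SameType {X = X} {σ} B c c′ =
    (v : List X) {Δ : List Sort} (b : All Carrier Δ) → _⊆ₚ_ b B →
    (φ : Formula L (map σ v ++ Δ)) →
    Sat (++⁺ (restrict c v) b) φ ⇔ Sat (++⁺ (restrict c′ v) b) φ

  -- The concatenation of the tuples a (i 0), …, a (i (n - 1)).
  select : {X I : Set ℓ} {σ : X → Sort} → (I → Tuple σ) →
           ∀ {n} → (Fin n → I) → Tuple {X = Fin n × X} (σ ∘ proj₂)
  select a i (k , x) = a (i k) x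

  IndiscernibleOver : ∀ {b} {X I : Set ℓ} {σ : X → Sort} →
                      Pred Element b → Rel I ℓ → (I → Tuple σ) → Set (ℓ ⊔ b)
  IndiscernibleOver {I = I} B _<_ a =
    ∀ {n} (i j : Fin n → I) →
    i Preserves Fin._<_ ⟶ _<_ → j Preserves Fin._<_ ⟶ _<_ →
    SameType B (select a i) (select a j)

  allEntries : {X I : Set ℓ} {σ : X → Sort} → (I → Tuple σ) → Pred Element ℓ
  allEntries {I = I} a e = Σ I λ i → entries (a i) e

module _ {ℓ : Level} {L : Language ℓ} where
  open Language L

  _⊨_ : Theory L → Sentence L → Set (lsuc ℓ)
  T ⊨ φ = (N : Structure L) → IsModelOf N T → _⊨ₛ_ N φ

  Consistent : Theory L → Set (lsuc ℓ)
  Consistent T = ¬ (T ⊨ ⊥ᶠ)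

  Complete : Theory L → Set (lsuc ℓ)
  Complete T = ∀ φ → (T ⊨ φ) ⊎ (T ⊨ (φ ⇒ᶠ ⊥ᶠ))

-- |A| < |κ|, for a type κ standing for its cardinality (by cardinal
-- comparability, that κ does not embed in A).
Small : {ℓ : Level} → Set ℓ → Set ℓ → Set ℓ
Small κ A = ¬ (κ ↣ A)

-- Every finitely satisfiable set p of formulas in one free variable of sort s,
-- over a parameter set of cardinality < κ (enumerated by c), is realised.
Saturated : {ℓ : Level} {L : Language ℓ} → Set ℓ → Structure L → Set (lsuc ℓ)
Saturated {ℓ} {L} κ M =
  {C : Set ℓ} → Small κ C → (σ : C → Sort) (c : Tuple M σ) (s : Sort)
  (p : Pred (∃ λ (v : List C) → Formula L (s ∷ map σ v)) ℓ) →
  let Holds : Carrier s → (∃ λ (v : List C) → Formula L (s ∷ map σ v)) → Set ℓ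
      Holds d (v , φ) = Sat M (d ∷ restrict M c v) φ
  in (∀ Φ → All p Φ → ∃ λ d → All (Holds d) Φ) →
     ∃ λ d → ∀ {ψ} → p ψ → Holds d ψ
  where
  open Language L
  open Structure M

-- A κ-saturated model of T with κ greater than the number of formulas; for
-- |κ| = |M| this is a saturated model, big compared with the language.
record IsBigSaturatedModel {ℓ : Level} {L : Language ℓ}
         (κ : Set ℓ) (T : Theory L) (M : Structure L) : Set (lsuc ℓ) where
  field
    isModel   : IsModelOf M T
    saturated : Saturated κ M
    big       : Small κ (∃ (Formula L))

-- Outside every finite list there is a further element.
Infinite : {ℓ : Level} → Set ℓ → Set ℓ
Infinite I = (xs : List I) → ∃ λ x → x ∉ xs

module _ {ℓ : Level} {L : Language ℓ} (κ : Set ℓ) (M : Structure L)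
         {X : Set ℓ} (σ : X → Language.Sort L) where

  record IndiscernibleSequence : Set (lsuc ℓ) where
    field
      Index              : Set ℓ
      _<_                : Rel Index ℓ
      isStrictTotalOrder : IsStrictTotalOrder _≡_ _<_
      infinite           : Infinite Index
      small              : Small κ Index
      tuple              : Index → Tuple M σ
      indiscernible      : IndiscernibleOver M ∅ _<_ tuple

module _ {ℓ : Level} {L : Language ℓ} {κ : Set ℓ} {M : Structure L}
         {X : Set ℓ} {σ : X → Language.Sort L} where
  open IndiscernibleSequence

  terms : IndiscernibleSequence κ M σ → Pred (Element M) ℓ
  terms A = allEntries M (tuple A)

  SequenceIndiscernibleOver : ∀ {b} → IndiscernibleSequence κ M σ → Pred (Element M) b → Set (ℓ ⊔ b)
  SequenceIndiscernibleOver A B = IndiscernibleOver M B (_<_ A) (tuple A)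

  ker : IndiscernibleSequence κ M σ → Pred (Element M) ℓ
  ker A d = dcl M (terms A) d × SequenceIndiscernibleOver A ｛ d ｝

  ConcatenationIndiscernible : Rel (IndiscernibleSequence κ M σ) ℓ
  ConcatenationIndiscernible A B =
    IndiscernibleOver M ∅ (_<_ A ⊎-< _<_ B) [ tuple A , tuple B ]

  CleanlyCollinear : Rel (IndiscernibleSequence κ M σ) ℓ
  CleanlyCollinear A B = ConcatenationIndiscernible A B ⊎ ConcatenationIndiscernible B A

  infix 4 _≈_

  _≈_ : Rel (IndiscernibleSequence κ M σ) (lsuc ℓ)
  _≈_ = TransClosure CleanlyCollinear

{-# OPTIONS --safe #-}

-- Sat is elementary in finitely many entries, so an indiscernible sequence takes the same truth values
-- along any two finite families of indices with the same order pattern, increasing or not.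
--
-- If the concatenation of A and B is indiscernible, A is indiscernible over the terms of B, hence over
-- dcl (terms B).  Conversely, let d = f(a_k) lie in the kernel of A.  Indiscernibility over d gives
-- d = f(a_u) for every increasing u, so f takes the same value at two consecutive blocks of A; moving one
-- of the blocks into B yields d = f(b_j).
--
-- For indiscernibility over several kernel elements d = f(a_k), adjoin one of them at a time.  To compare
-- a_i with a_i' over d, choose v in a long chain with a gap wide enough for k between any two consecutive
-- entries.  Then (i , k) has the order pattern of some (v , l), and (i' , k) that of some (v , l'),
-- while f(a_l) = d = f(a_l'); so a_i and a_i' both have the type of a_v.
module Submission where

open import Defs
open import Level using (Level; _⊔_)
open import Data.Fin using (Fin; fromℕ<; _↑ˡ_; _↑ʳ_)
import Data.Fin as Fin
import Data.Fin.Properties as Fin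
open import Data.List using (List; []; _∷_; _++_; map; length; filter; foldr; allFin)
import Data.List as List
open import Data.List.Membership.Propositional using (_∈_)
open import Data.List.Membership.Propositional.Properties using (∈-++⁺ˡ; ∈-++⁺ʳ; ∈-allFin; ∈-lookup)
open import Data.List.Properties using (length-filter; filter-≐; length-tabulate)
open import Data.List.Relation.Binary.Subset.Propositional using (_⊆_)
open import Data.List.Relation.Unary.All using (All; []; _∷_; lookup)
import Data.List.Relation.Unary.All as All
open import Data.List.Relation.Unary.All.Properties using (++⁺)
open import Data.List.Relation.Unary.AllPairs using (AllPairs; []; _∷_)
open import Data.List.Relation.Unary.Any using (Any; here; there)
import Data.List.Relation.Unary.Any as Any
open import Data.List.Relation.Unary.Any.Properties using (lookup-index)
open import Data.Nat using (ℕ; zero; suc; z≤n; s≤s)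
import Data.Nat as ℕ
import Data.Nat.Properties as ℕ
open import Data.Product using (∃; _×_; _,_; proj₁; proj₂; swap)
open import Data.Product.Function.NonDependent.Propositional using (_×-⇔_)
open import Data.Sum using (_⊎_; inj₁; inj₂; [_,_]; [_,_]′)
import Data.Sum as Sum
open import Data.Sum.Function.Propositional using (_⊎-⇔_)
open import Data.Sum.Relation.Binary.LeftOrder using (_⊎-<_; ₁∼₁; ₁∼₂; ₂∼₂; ⊎-<-isStrictTotalOrder)
open import Data.Sum.Relation.Binary.Pointwise using (Pointwise-≡⇒≡; ≡⇒Pointwise-≡)
open import Function using (_∘_; id; _⇔_; mk⇔; Equivalence)
open import Function.Construct.Composition using (_⇔-∘_)
open import Function.Construct.Identity using (⇔-id)
open import Function.Construct.Symmetry using (⇔-sym)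
open import Relation.Binary.Core using (Rel; _Preserves_⟶_)
open import Relation.Binary.Construct.Closure.Transitive using (_∷_) renaming ([_] to single)
open import Relation.Binary.Definitions using (Trichotomous; tri<; tri≈; tri>)
open import Relation.Binary.PropositionalEquality
  using (_≡_; refl; sym; trans; cong; cong₂; subst; subst₂; isEquivalence)
open import Relation.Binary.Structures using (IsStrictTotalOrder)
open import Relation.Nullary using (¬_; Dec; yes; no; ¬?; contradiction)
open import Relation.Unary using (Pred; Decidable; _≐_; _∩_; ∅; ｛_｝)
open import Relation.Unary.Properties using (≐-sym; ≐-trans)

open Equivalence using (to; from)

-- Inclusions of contexts and the assignments they relate.

module _ {a} {A : Set a} where

  [_,_]⊆ : ∀ {Γ Δ Θ : List A} → Γ ⊆ Θ → Δ ⊆ Θ → Γ ++ Δ ⊆ Θ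
  [_,_]⊆ {[]}    r r′ x           = r′ x
  [_,_]⊆ {_ ∷ _} r r′ (here refl) = r (here refl)
  [_,_]⊆ {_ ∷ _} r r′ (there x)   = [ r ∘ there , r′ ]⊆ x

  infixr 5 _▹_

  _▹_ : ∀ {s} {Γ Δ : List A} → s ∈ Δ → Γ ⊆ Δ → s ∷ Γ ⊆ Δ
  (x ▹ r) (here refl) = x
  (x ▹ r) (there y)   = r y

module _ {a p} {A : Set a} {P : A → Set p} where

  -- Assignments are compared through lookups along `r`, so contexts that differ by weakening,
  -- rotation or reassociation need no transport along equations between lists.
  record Agree {Γ Δ : List A} (r : Γ ⊆ Δ) (ρ : All P Γ) (ρ′ : All P Δ) : Set (a ⊔ p) where
    constructor agree
    field lookup≡ : ∀ {s} (x : s ∈ Γ) → lookup ρ x ≡ lookup ρ′ (r x)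
  open Agree public

  agree-id : ∀ {Γ} {ρ : All P Γ} → Agree id ρ ρ
  agree-id = agree λ _ → refl

  agree-∘ : ∀ {Γ Δ Θ} {r : Γ ⊆ Δ} {r′ : Δ ⊆ Θ} {ρ : All P Γ} {ρ′ : All P Δ} {ρ″ : All P Θ} →
            Agree r ρ ρ′ → Agree r′ ρ′ ρ″ → Agree (r′ ∘ r) ρ ρ″
  agree-∘ {r = r} g h = agree λ x → trans (lookup≡ g x) (lookup≡ h (r x))

  agree-there : ∀ {Γ s} {ρ : All P Γ} {d : P s} → Agree there ρ (d ∷ ρ)
  agree-there = agree λ _ → refl

  agree-▹ : ∀ {Γ Δ s} {r : Γ ⊆ Δ} {ρ : All P Γ} {ρ′ : All P Δ} {x : s ∈ Δ} {d : P s} →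
            d ≡ lookup ρ′ x → Agree r ρ ρ′ → Agree (x ▹ r) (d ∷ ρ) ρ′
  agree-▹ eq g = agree λ { (here refl) → eq ; (there y) → lookup≡ g y }

  agree-lift : ∀ {Γ Δ s} {r : Γ ⊆ Δ} {ρ : All P Γ} {ρ′ : All P Δ} {d : P s} →
               Agree r ρ ρ′ → Agree (here refl ▹ there ∘ r) (d ∷ ρ) (d ∷ ρ′)
  agree-lift g = agree-▹ refl (agree-∘ g agree-there)

  agree-[,] : ∀ {Γ Δ Θ} {r : Γ ⊆ Θ} {r′ : Δ ⊆ Θ} {ρ : All P Γ} {ρ′ : All P Δ} {θ : All P Θ} →
              Agree r ρ θ → Agree r′ ρ′ θ → Agree [ r , r′ ]⊆ (++⁺ ρ ρ′) θ
  agree-[,] {ρ = []}    g h = h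
  agree-[,] {ρ = d ∷ ρ} g h = agree λ
    { (here refl) → lookup≡ g (here refl)
    ; (there x)   → lookup≡ (agree-[,] (agree {ρ = ρ} (lookup≡ g ∘ there)) h) x }

  agree-++ˡ : ∀ {Γ Δ} (ρ : All P Γ) (ρ′ : All P Δ) → Agree ∈-++⁺ˡ ρ (++⁺ ρ ρ′)
  agree-++ˡ []      ρ′ = agree λ ()
  agree-++ˡ (_ ∷ ρ) ρ′ = agree λ
    { (here refl) → refl
    ; (there x)   → lookup≡ (agree-++ˡ ρ ρ′) x }

  agree-++ʳ : ∀ {Γ Δ} (ρ : All P Γ) (ρ′ : All P Δ) → Agree (∈-++⁺ʳ Γ) ρ′ (++⁺ ρ ρ′)
  agree-++ʳ []      ρ′ = agree-id
  agree-++ʳ (_ ∷ ρ) ρ′ = agree-∘ (agree-++ʳ ρ ρ′) agree-there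

-- Renaming of variables in formulas.

module _ {ℓ : Level} {L : Language ℓ} where
  open Language L

  mutual
    renameᵗ : ∀ {Γ Δ s} → Γ ⊆ Δ → Term L Γ s → Term L Δ s
    renameᵗ r (var x)    = var (r x)
    renameᵗ r (fun f ts) = fun f (renameᵗˢ r ts)

    renameᵗˢ : ∀ {Γ Δ Θ} → Γ ⊆ Δ → All (Term L Γ) Θ → All (Term L Δ) Θ
    renameᵗˢ r []       = []
    renameᵗˢ r (t ∷ ts) = renameᵗ r t ∷ renameᵗˢ r ts

  rename : ∀ {Γ Δ} → Γ ⊆ Δ → Formula L Γ → Formula L Δ
  rename r (t ≈ᶠ u)   = renameᵗ r t ≈ᶠ renameᵗ r u
  rename r (rel R ts) = rel R (renameᵗˢ r ts)
  rename r ⊥ᶠ         = ⊥ᶠ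
  rename r (φ ⇒ᶠ ψ)   = rename r φ ⇒ᶠ rename r ψ
  rename r (φ ∧ᶠ ψ)   = rename r φ ∧ᶠ rename r ψ
  rename r (φ ∨ᶠ ψ)   = rename r φ ∨ᶠ rename r ψ
  rename r (∀ᶠ s φ)   = ∀ᶠ s (rename (here refl ▹ there ∘ r) φ)
  rename r (∃ᶠ s φ)   = ∃ᶠ s (rename (here refl ▹ there ∘ r) φ)

module _ {ℓ : Level} {L : Language ℓ} (M : Structure L) where
  open Language L
  open Structure M

  mutual
    eval-rename : ∀ {Γ Δ s} {r : Γ ⊆ Δ} {ρ ρ′} → Agree r ρ ρ′ → (t : Term L Γ s) →
                  eval M ρ t ≡ eval M ρ′ (renameᵗ r t)
    eval-rename g (var x)    = lookup≡ g x
    eval-rename g (fun f ts) = cong (⟦fun⟧ f) (evals-rename g ts)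

    evals-rename : ∀ {Γ Δ Θ} {r : Γ ⊆ Δ} {ρ ρ′} → Agree r ρ ρ′ → (ts : All (Term L Γ) Θ) →
                   evals M ρ ts ≡ evals M ρ′ (renameᵗˢ r ts)
    evals-rename g []       = refl
    evals-rename g (t ∷ ts) = cong₂ _∷_ (eval-rename g t) (evals-rename g ts)

  sat-rename : ∀ {Γ Δ} {r : Γ ⊆ Δ} {ρ ρ′} → Agree r ρ ρ′ → (φ : Formula L Γ) →
               Sat M ρ φ ⇔ Sat M ρ′ (rename r φ)
  sat-rename g (t ≈ᶠ u)
    rewrite eval-rename g t | eval-rename g u = ⇔-id _
  sat-rename g (rel R ts)
    rewrite evals-rename g ts = ⇔-id _
  sat-rename g ⊥ᶠ       = ⇔-id _
  sat-rename g (φ ⇒ᶠ ψ) =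
    mk⇔ (λ h → to (sat-rename g ψ) ∘ h ∘ from (sat-rename g φ))
        (λ h → from (sat-rename g ψ) ∘ h ∘ to (sat-rename g φ))
  sat-rename g (φ ∧ᶠ ψ) = sat-rename g φ ×-⇔ sat-rename g ψ
  sat-rename g (φ ∨ᶠ ψ) = sat-rename g φ ⊎-⇔ sat-rename g ψ
  sat-rename g (∀ᶠ s φ) =
    mk⇔ (λ h d → to (sat-rename (agree-lift g) φ) (h d))
        (λ h d → from (sat-rename (agree-lift g) φ) (h d))
  sat-rename g (∃ᶠ s φ) =
    mk⇔ (λ (d , h) → d , to (sat-rename (agree-lift g) φ) h)
        (λ (d , h) → d , from (sat-rename (agree-lift g) φ) h)

  -- Definable elements

  Defines : ∀ {Θ s} → Formula L (s ∷ Θ) → All Carrier Θ → Carrier s → Set ℓ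
  Defines φ e d = Sat M (d ∷ e) φ × (∀ y → Sat M (y ∷ e) φ → y ≡ d)

  definesᶠ : ∀ {Θ s} → Formula L (s ∷ Θ) → Formula L (s ∷ Θ)
  definesᶠ {s = s} φ =
    φ ∧ᶠ ∀ᶠ s (rename (here refl ▹ there ∘ there) φ ⇒ᶠ (var (here refl) ≈ᶠ var (there (here refl))))

  sat-definesᶠ : ∀ {Θ s} (φ : Formula L (s ∷ Θ)) {e d} → Sat M (d ∷ e) (definesᶠ φ) ⇔ Defines φ e d
  sat-definesᶠ φ =
    mk⇔ (λ (h , u) → h , λ y → u y ∘ to (sat-rename g φ))
        (λ (h , u) → h , λ y → u y ∘ from (sat-rename g φ))
    where
    g : ∀ {Θ s} {e : All Carrier Θ} {d y : Carrier s} →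
        Agree (here refl ▹ there ∘ there) (y ∷ e) (y ∷ d ∷ e)
    g = agree-▹ refl (agree-∘ agree-there agree-there)

  -- `φ′` says that some solution of `ψ` satisfies `φ`. It is fixed before the assignments are, so
  -- one formula serves both sides of an equivalence; the defining tuple `e` joins the left block,
  -- which can therefore grow in an induction on the parameters.
  eliminate : ∀ {Γ Θ Δ s} (ψ : Formula L (s ∷ Θ)) (φ : Formula L (Γ ++ s ∷ Δ)) →
              ∃ λ (φ′ : Formula L ((Γ ++ Θ) ++ Δ)) →
              ∀ {ρ e d b} → Defines ψ e d →
              Sat M (++⁺ ρ (d ∷ b)) φ ⇔ Sat M (++⁺ (++⁺ ρ e) b) φ′
  eliminate {Γ} {Θ} {Δ} {s} ψ φ = ∃ᶠ s (rename _ ψ ∧ᶠ rename _ φ) , λ {ρ} {e} {d} {b} (h , unique) → mk⇔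
    (λ p → d , to (sat-rename (g ρ e b) ψ) h , to (sat-rename (k ρ e b) φ) p)
    (λ (y , q , p) → subst (λ z → Sat M (++⁺ ρ (z ∷ b)) φ)
      (unique y (from (sat-rename (g ρ e b) ψ) q)) (from (sat-rename (k ρ e b) φ) p))
    where
    g : ∀ (ρ : All Carrier Γ) (e : All Carrier Θ) (b : All Carrier Δ) {d : Carrier s} →
        Agree _ (d ∷ e) (d ∷ ++⁺ (++⁺ ρ e) b)
    g ρ e b = agree-lift (agree-∘ (agree-++ʳ ρ e) (agree-++ˡ (++⁺ ρ e) b))

    k : ∀ (ρ : All Carrier Γ) (e : All Carrier Θ) (b : All Carrier Δ) {d : Carrier s} →
        Agree _ (++⁺ ρ (d ∷ b)) (d ∷ ++⁺ (++⁺ ρ e) b)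
    k ρ e b = agree-[,]
      (agree-∘ (agree-++ˡ ρ e) (agree-∘ (agree-++ˡ (++⁺ ρ e) b) agree-there))
      (agree-lift (agree-++ʳ (++⁺ ρ e) b))

-- Definable closure and equivalence over parameters.

module _ {ℓ : Level} {L : Language ℓ} (M : Structure L) where
  open Language L
  open Structure M

  ⊆ₚ-++ : ∀ {b Γ Δ} (B : Pred (Element M) b) (ρ : All Carrier Γ) (ρ′ : All Carrier Δ) →
          _⊆ₚ_ M ρ B → _⊆ₚ_ M ρ′ B → _⊆ₚ_ M (++⁺ ρ ρ′) B
  ⊆ₚ-++ B []      ρ′ h h′ x           = h′ x
  ⊆ₚ-++ B (_ ∷ _) ρ′ h h′ (here refl) = h (here refl)
  ⊆ₚ-++ B (_ ∷ ρ) ρ′ h h′ (there x)   = ⊆ₚ-++ B ρ ρ′ (h ∘ there) h′ x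

  ⊆-dcl : ∀ {b} {B : Pred (Element M) b} {x} → B x → dcl M B x
  ⊆-dcl {x = s , d} h =
    s ∷ [] , d ∷ [] , (λ { (here refl) → h }) , (var (here refl) ≈ᶠ var (there (here refl))) ,
    refl , λ _ → id

  -- The parameters from `C` are traded one at a time for defining tuples from `D`; the accumulator
  -- `e` of `go` holds the tuples obtained so far.
  dcl-trans : ∀ {c d} (C : Pred (Element M) c) (D : Pred (Element M) d) →
              (∀ {x} → C x → dcl M D x) → ∀ {x} → dcl M C x → dcl M D x
  dcl-trans C D C⊆dclD {s , d} (_ , b , b⊆C , φ , def) = go b b⊆C [] (λ ()) φ def
    where
    go : ∀ {Δ Θ} (b : All Carrier Δ) → _⊆ₚ_ M b C → (e : All Carrier Θ) → _⊆ₚ_ M e D →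
         (φ : Formula L (s ∷ Θ ++ Δ)) → Defines M φ (++⁺ e b) d → dcl M D (s , d)
    go []       b⊆C e e⊆D φ def = _ , ++⁺ e [] , ⊆ₚ-++ D e [] e⊆D (λ ()) , φ , def
    go (d′ ∷ b) b⊆C e e⊆D φ (h , unique) with C⊆dclD (b⊆C (here refl))
    ... | _ , e′ , e′⊆D , ψ , def′ with eliminate M {Γ = s ∷ _} ψ φ
    ... | φ′ , φ⇔φ′ = go b (b⊆C ∘ there) (++⁺ e e′) (⊆ₚ-++ D e e′ e⊆D e′⊆D) φ′
      ( to (φ⇔φ′ {ρ = d ∷ e} def′) h
      , λ y → unique y ∘ from (φ⇔φ′ {ρ = y ∷ e} def′))

  -- The finite form of `SameType`: unlike a restriction of a fixed tuple, an assignment can be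
  -- extended by parameters.
  EquivalentOver : ∀ {b Γ} → Pred (Element M) b → All Carrier Γ → All Carrier Γ → Set (ℓ ⊔ b)
  EquivalentOver {Γ = Γ} B ρ ρ′ =
    ∀ {Δ} (b : All Carrier Δ) → _⊆ₚ_ M b B → (φ : Formula L (Γ ++ Δ)) →
    Sat M (++⁺ ρ b) φ ⇔ Sat M (++⁺ ρ′ b) φ

  equivalentOver-++ : ∀ {b Γ Δ} (B : Pred (Element M) b) {ρ ρ′ : All Carrier Γ} (e : All Carrier Δ) →
                      _⊆ₚ_ M e B → EquivalentOver B ρ ρ′ → EquivalentOver B (++⁺ ρ e) (++⁺ ρ′ e)
  equivalentOver-++ {Γ = Γ} B e e⊆B h b b⊆B φ =
    ⇔-sym (sat-rename M (assoc _) φ)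
      ⇔-∘ (h (++⁺ e b) (⊆ₚ-++ B e b e⊆B b⊆B) (rename _ φ)
      ⇔-∘ sat-rename M (assoc _) φ)
    where
    assoc : ∀ (ρ : All Carrier Γ) → Agree _ (++⁺ (++⁺ ρ e) b) (++⁺ ρ (++⁺ e b))
    assoc ρ = agree-[,]
      (agree-[,] (agree-++ˡ ρ (++⁺ e b)) (agree-∘ (agree-++ˡ e b) (agree-++ʳ ρ (++⁺ e b))))
      (agree-∘ (agree-++ʳ e b) (agree-++ʳ ρ (++⁺ e b)))

  -- The tuple from `C` that defines the first parameter is appended to both assignments, which stay
  -- equivalent over `C`; this leaves one parameter fewer.
  equivalentOver-dcl : ∀ {c d} (C : Pred (Element M) c) (D : Pred (Element M) d) →
                       (∀ {x} → D x → dcl M C x) → ∀ {Γ} {ρ ρ′ : All Carrier Γ} →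
                       EquivalentOver C ρ ρ′ → EquivalentOver D ρ ρ′
  equivalentOver-dcl C D D⊆dclC h []      _   φ = h [] (λ ()) φ
  equivalentOver-dcl C D D⊆dclC h (d ∷ b) b⊆D φ with D⊆dclC (b⊆D (here refl))
  ... | _ , e , e⊆C , ψ , def with eliminate M ψ φ
  ... | φ′ , φ⇔φ′ =
    ⇔-sym (φ⇔φ′ def)
      ⇔-∘ (equivalentOver-dcl C D D⊆dclC (equivalentOver-++ C e e⊆C h) b (b⊆D ∘ there) φ′
      ⇔-∘ φ⇔φ′ def)

  indiscernibleOver-dcl : ∀ {c d} (C : Pred (Element M) c) (D : Pred (Element M) d) →
                          (∀ {x} → D x → dcl M C x) →
                          {X I : Set ℓ} {σ : X → Sort} (_<_ : Rel I ℓ) (a : I → Tuple M σ) →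
                          IndiscernibleOver M C _<_ a → IndiscernibleOver M D _<_ a
  indiscernibleOver-dcl C D D⊆dclC _<_ a h i j i↗ j↗ v = equivalentOver-dcl C D D⊆dclC (h i j i↗ j↗ v)

-- Counting in finite lists.

module _ {a p q} {A : Set a} {P : Pred A p} {Q : Pred A q} (P? : Decidable P) (Q? : Decidable Q)
         (P⊆Q : ∀ {x} → P x → Q x) where

  length-filter-mono : ∀ xs → length (filter P? xs) ℕ.≤ length (filter Q? xs)
  length-filter-mono []       = z≤n
  length-filter-mono (x ∷ xs) with P? x | Q? x
  ... | yes _  | yes _ = s≤s (length-filter-mono xs)
  ... | yes Px | no ¬Qx = contradiction (P⊆Q Px) ¬Qx
  ... | no _   | yes _ = ℕ.m≤n⇒m≤1+n (length-filter-mono xs)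
  ... | no _   | no _  = length-filter-mono xs

  length-filter-strict : ∀ {x xs} → x ∈ xs → ¬ P x → Q x →
                         length (filter P? xs) ℕ.< length (filter Q? xs)
  length-filter-strict {xs = x ∷ xs} (here refl) ¬Px Qx with P? x | Q? x
  ... | yes Px | _      = contradiction Px ¬Px
  ... | no _   | yes _  = s≤s (length-filter-mono xs)
  ... | no _   | no ¬Qx = contradiction Qx ¬Qx
  length-filter-strict {xs = y ∷ xs} (there x∈xs) ¬Px Qx with P? y | Q? y
  ... | yes _  | yes _  = s≤s (length-filter-strict x∈xs ¬Px Qx)
  ... | yes Py | no ¬Qy = contradiction (P⊆Q Py) ¬Qy
  ... | no _   | yes _  = ℕ.m≤n⇒m≤1+n (length-filter-strict x∈xs ¬Px Qx)
  ... | no _   | no _   = length-filter-strict x∈xs ¬Px Qx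

length-filter-allFin : ∀ {n p} {P : Pred (Fin n) p} (P? : Decidable P) →
                       length (filter P? (allFin n)) ℕ.≤ n
length-filter-allFin {n} P? = ℕ.≤-trans (length-filter P? (allFin n)) (ℕ.≤-reflexive (length-tabulate id))

lookup-increasing : ∀ {a r} {A : Set a} {R : Rel A r} {xs : List A} → AllPairs R xs →
                    List.lookup xs Preserves Fin._<_ ⟶ R
lookup-increasing (Rx ∷ _)  {Fin.zero}  {Fin.suc j} _         = All.lookup Rx (∈-lookup j)
lookup-increasing (_ ∷ Rxs) {Fin.suc i} {Fin.suc j} (s≤s i<j) = lookup-increasing Rxs i<j

-- Finite families in a linear order and their order patterns.

module _ {i ℓ} {I : Set i} {_<_ : Rel I ℓ} (isSTO : IsStrictTotalOrder _≡_ _<_) where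
  open IsStrictTotalOrder isSTO using (compare; irrefl; asym; _<?_; _≟_) renaming (trans to <-trans)

  increasing-reflects : ∀ {n} {k : Fin n → I} → k Preserves Fin._<_ ⟶ _<_ →
                        ∀ s t → (k s < k t → s Fin.< t) × (k s ≡ k t → s ≡ t)
  increasing-reflects k↗ s t with Fin.<-cmp s t
  ... | tri< s<t _ _  = (λ _ → s<t) , (λ eq → contradiction (k↗ s<t) (irrefl eq))
  ... | tri≈ _ refl _ = (λ lt → contradiction lt (irrefl refl)) , (λ _ → refl)
  ... | tri> _ _ t<s  = (λ lt → contradiction (k↗ t<s) (asym lt))
                      , (λ eq → contradiction (k↗ t<s) (irrefl (sym eq)))

  module _ {f} {F : Set f} (p : F → I) where

    -- An element whose key is present already is dropped, so that sorting gives a strictly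
    -- increasing family, the only kind that indiscernibility speaks of.
    insert : F → List F → List F
    insert x []       = x ∷ []
    insert x (y ∷ ys) with compare (p x) (p y)
    ... | tri< _ _ _ = x ∷ y ∷ ys
    ... | tri≈ _ _ _ = y ∷ ys
    ... | tri> _ _ _ = y ∷ insert x ys

    insert-All : ∀ {r} {R : Pred F r} {x ys} → R x → All R ys → All R (insert x ys)
    insert-All                        Rx []         = Rx ∷ []
    insert-All {x = x} {ys = y ∷ _} Rx (Ry ∷ Rys) with compare (p x) (p y)
    ... | tri< _ _ _ = Rx ∷ Ry ∷ Rys
    ... | tri≈ _ _ _ = Ry ∷ Rys
    ... | tri> _ _ _ = Ry ∷ insert-All Rx Rys

    Ascending : List F → Set _
    Ascending = AllPairs λ x y → p x < p y

    insert-ascending : ∀ x {ys} → Ascending ys → Ascending (insert x ys)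
    insert-ascending x []                   = [] ∷ []
    insert-ascending x {y ∷ _} (y< ∷ ys↗) with compare (p x) (p y)
    ... | tri< x<y _ _ = (x<y ∷ All.map (<-trans x<y) y<) ∷ y< ∷ ys↗
    ... | tri≈ _ _ _   = y< ∷ ys↗
    ... | tri> _ _ y<x = insert-All y<x y< ∷ insert-ascending x ys↗

    insert-here : ∀ x ys → Any (λ y → p x ≡ p y) (insert x ys)
    insert-here x []       = here refl
    insert-here x (y ∷ ys) with compare (p x) (p y)
    ... | tri< _ _ _  = here refl
    ... | tri≈ _ eq _ = here eq
    ... | tri> _ _ _  = there (insert-here x ys)

    insert-there : ∀ {r} {R : Pred F r} x {ys} → Any R ys → Any R (insert x ys)
    insert-there x {y ∷ _} any with compare (p x) (p y)
    insert-there x any         | tri< _ _ _ = there any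
    insert-there x any         | tri≈ _ _ _ = any
    insert-there x (here Ry)   | tri> _ _ _ = here Ry
    insert-there x (there any) | tri> _ _ _ = there (insert-there x any)

    insert-length : ∀ x ys → ¬ Any (λ y → p x ≡ p y) ys → length (insert x ys) ≡ suc (length ys)
    insert-length x []       _    = refl
    insert-length x (y ∷ ys) x∉ys with compare (p x) (p y)
    ... | tri< _ _ _  = refl
    ... | tri≈ _ eq _ = contradiction (here eq) x∉ys
    ... | tri> _ _ _  = cong suc (insert-length x ys (x∉ys ∘ there))

    -- Labels are sorted rather than their values under `p`, so the representatives `r` can be
    -- composed with a second family on the same labels.
    sort : ∀ xs → ∃ λ n → ∃ λ (r : Fin n → F) →
           (p ∘ r) Preserves Fin._<_ ⟶ _<_ × (∀ {x} → x ∈ xs → ∃ λ t → p x ≡ p (r t))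
    sort xs = length (sorted xs) , List.lookup (sorted xs) , lookup-increasing (ascending xs)
            , λ x∈xs → Any.index (covered x∈xs) , lookup-index (covered x∈xs)
      where
      sorted : List F → List F
      sorted = foldr insert []

      ascending : ∀ xs → Ascending (sorted xs)
      ascending []       = []
      ascending (x ∷ xs) = insert-ascending x (ascending xs)

      covered : ∀ {x xs} → x ∈ xs → Any (λ y → p x ≡ p y) (sorted xs)
      covered {x} {_ ∷ xs} (here refl)  = insert-here x (sorted xs)
      covered     {xs = y ∷ _} (there x∈xs) = insert-there y (covered x∈xs)

  chain : Infinite I → ∀ n → ∃ λ (c : Fin n → I) → c Preserves Fin._<_ ⟶ _<_
  chain inf n with go n
    where
    go : ∀ n → ∃ λ xs → length xs ≡ n × Ascending id xs
    go zero    = [] , refl , []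
    go (suc n) with go n
    ... | xs , refl , xs↗ with inf xs
    ... | x , x∉xs = insert id x xs , insert-length id x xs x∉xs , insert-ascending id x xs↗
  ... | xs , refl , xs↗ = List.lookup xs , lookup-increasing xs↗

  -- By trichotomy the two clauses also give the converse implications: `p` and `q` have the same
  -- order pattern, with repetitions allowed.
  record Transfers {f} {F : Set f} (p q : F → I) : Set (i ⊔ ℓ ⊔ f) where
    field
      <-transfer : ∀ x y → p x < p y → q x < q y
      ≡-transfer : ∀ x y → p x ≡ p y → q x ≡ q y

  module _ {m n} {p p′ : Fin m → I} {q q′ : Fin n → I} where

    -- Inside a block the pattern is that of `Fin`, so only comparisons across the blocks have to be
    -- supplied; `cross` also rules out a common value of `p` and `q`.
    transfers-blocks : p Preserves Fin._<_ ⟶ _<_ → p′ Preserves Fin._<_ ⟶ _<_ →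
                       q Preserves Fin._<_ ⟶ _<_ → q′ Preserves Fin._<_ ⟶ _<_ →
                       (∀ s t → (p s < q t × p′ s < q′ t) ⊎ (q t < p s × q′ t < p′ s)) →
                       Transfers [ p , q ] [ p′ , q′ ]
    transfers-blocks p↗ p′↗ q↗ q′↗ cross = record { <-transfer = lt ; ≡-transfer = eq }
      where
      lt : ∀ x y → [ p , q ] x < [ p , q ] y → [ p′ , q′ ] x < [ p′ , q′ ] y
      lt (inj₁ s) (inj₁ t) h = p′↗ (proj₁ (increasing-reflects p↗ s t) h)
      lt (inj₂ s) (inj₂ t) h = q′↗ (proj₁ (increasing-reflects q↗ s t) h)
      lt (inj₁ s) (inj₂ t) h with cross s t
      ... | inj₁ (_ , h′) = h′
      ... | inj₂ (h′ , _) = contradiction h′ (asym h)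
      lt (inj₂ t) (inj₁ s) h with cross s t
      ... | inj₁ (h′ , _) = contradiction h′ (asym h)
      ... | inj₂ (_ , h′) = h′

      apart : ∀ s t → ¬ p s ≡ q t
      apart s t h with cross s t
      ... | inj₁ (h′ , _) = irrefl h h′
      ... | inj₂ (h′ , _) = irrefl (sym h) h′

      eq : ∀ x y → [ p , q ] x ≡ [ p , q ] y → [ p′ , q′ ] x ≡ [ p′ , q′ ] y
      eq (inj₁ s) (inj₁ t) h = cong p′ (proj₂ (increasing-reflects p↗ s t) h)
      eq (inj₂ s) (inj₂ t) h = cong q′ (proj₂ (increasing-reflects q↗ s t) h)
      eq (inj₁ s) (inj₂ t) h = contradiction h (apart s t)
      eq (inj₂ t) (inj₁ s) h = contradiction (sym h) (apart s t)

  -- Order-preserving on the entries of u and k, and at u t equal to a number depending on t alone: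
  -- the multiples of n + 2 are kept for the entries of u, which leaves room for k between them.
  module _ {m n} (u : Fin m → I) (k : Fin n → I) where

    block : I → ℕ
    block z = length (filter (λ t → ¬? (z <? u t)) (allFin m))

    offset : I → ℕ
    offset z with Fin.any? (λ t → u t ≟ z)
    ... | yes _ = 0
    -- The `suc` keeps offset 0 for the entries of `u`, so offsets range from 0 to `n + 1`.
    ... | no  _ = suc (length (filter (λ s → k s <? z) (allFin n)))

    position : I → ℕ
    position z = block z ℕ.* suc (suc n) ℕ.+ offset z

    offset<2+n : ∀ z → offset z ℕ.< suc (suc n)
    offset<2+n z with Fin.any? (λ t → u t ≟ z)
    ... | yes _ = s≤s z≤n
    ... | no  _ = s≤s (s≤s (length-filter-allFin (λ s → k s <? z)))

    -- No offset reaches the block width `n + 2`, so the larger block wins whatever the offsets are.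
    position-strict : ∀ {z z′} → block z ℕ.< block z′ → position z ℕ.< position z′
    position-strict {z} {z′} lt = begin-strict
      block z ℕ.* suc (suc n) ℕ.+ offset z    <⟨ ℕ.+-monoʳ-< (block z ℕ.* suc (suc n)) (offset<2+n z) ⟩
      block z ℕ.* suc (suc n) ℕ.+ suc (suc n) ≡⟨ ℕ.+-comm (block z ℕ.* suc (suc n)) _ ⟩
      suc (block z) ℕ.* suc (suc n)           ≤⟨ ℕ.*-monoˡ-≤ (suc (suc n)) lt ⟩
      block z′ ℕ.* suc (suc n)                ≤⟨ ℕ.m≤m+n _ _ ⟩
      position z′                             ∎
      where open ℕ.≤-Reasoning

    position-bound : ∀ z → position z ℕ.< suc m ℕ.* suc (suc n)
    position-bound z = begin-strict
      block z ℕ.* suc (suc n) ℕ.+ offset z    <⟨ ℕ.+-monoʳ-< (block z ℕ.* suc (suc n)) (offset<2+n z) ⟩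
      block z ℕ.* suc (suc n) ℕ.+ suc (suc n) ≡⟨ ℕ.+-comm (block z ℕ.* suc (suc n)) _ ⟩
      suc (block z) ℕ.* suc (suc n)           ≤⟨ ℕ.*-monoˡ-≤ (suc (suc n)) (s≤s block≤m) ⟩
      suc m ℕ.* suc (suc n)                   ∎
      where
      open ℕ.≤-Reasoning
      block≤m = length-filter-allFin (λ t → ¬? (z <? u t))

    offset-base : ∀ t → offset (u t) ≡ 0
    offset-base t with Fin.any? (λ s → u s ≟ u t)
    ... | yes _ = refl
    ... | no ∄s = contradiction (t , refl) ∄s

    offset-strict : ∀ x {z} → [ u , k ] x < z → ¬ (∃ λ t → u t ≡ z) → offset ([ u , k ] x) ℕ.< offset z
    offset-strict x {z} lt ∄t with Fin.any? (λ t → u t ≟ z) | Fin.any? (λ t → u t ≟ [ u , k ] x)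
    ... | yes ∃t | _      = contradiction ∃t ∄t
    ... | no _   | yes _  = s≤s z≤n
    offset-strict (inj₁ t) lt _ | no _ | no ∄s = contradiction (t , refl) ∄s
    offset-strict (inj₂ s) lt _ | no _ | no _  =
      s≤s (length-filter-strict _ _ (λ h → <-trans h lt) (∈-allFin s) (irrefl refl) lt)

    -- If `z` is an entry of `u`, that entry is counted in the block of `z` only, and the block
    -- grows. Otherwise the block does not shrink and the offset grows.
    position-increasing : ∀ x {z} → [ u , k ] x < z → position ([ u , k ] x) ℕ.< position z
    position-increasing x {z} lt = by-cases (Fin.any? (λ t → u t ≟ z))
      where
      block⊆ : ∀ {t} → ¬ [ u , k ] x < u t → ¬ z < u t
      block⊆ ≮u z<u = ≮u (<-trans lt z<u)

      by-cases : Dec (∃ λ t → u t ≡ z) → position ([ u , k ] x) ℕ.< position z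
      by-cases (yes (t , refl)) =
        position-strict (length-filter-strict _ _ block⊆ (∈-allFin t) (λ ≮u → ≮u lt) (irrefl refl))
      by-cases (no ∄t) =
        ℕ.+-mono-≤-< (ℕ.*-monoˡ-≤ (suc (suc n)) (length-filter-mono _ _ block⊆ (allFin m)))
                     (offset-strict x lt ∄t)

    -- The right-hand side does not mention the values of `u`, so any two increasing families of
    -- length `m` get the same positions.
    position-base : u Preserves Fin._<_ ⟶ _<_ → ∀ t →
                    position (u t) ≡ length (filter (λ s → ¬? (t Fin.<? s)) (allFin m)) ℕ.* suc (suc n) ℕ.+ 0
    position-base u↗ t = cong₂ (λ v w → v ℕ.* suc (suc n) ℕ.+ w)
      (cong length (filter-≐ _ _ ((λ h → h ∘ u↗) , λ h → h ∘ proj₁ (increasing-reflects u↗ t _)) (allFin m)))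
      (offset-base t)

  -- Blocks are numbered from 0 to `m` and have width `n + 2`, whence the length of the chain.
  module _ {m n} (c : Fin (suc m ℕ.* suc (suc n)) → I) (c↗ : c Preserves Fin._<_ ⟶ _<_) where

    place : (Fin m → I) → (Fin n → I) → I → I
    place u k z = c (fromℕ< (position-bound u k z))

    transfers-place : ∀ u k → Transfers [ u , k ] (place u k ∘ [ u , k ])
    transfers-place u k = record
      { <-transfer = λ x y lt → c↗ (subst₂ ℕ._<_ (sym (Fin.toℕ-fromℕ< _)) (sym (Fin.toℕ-fromℕ< _))
                                            (position-increasing u k x lt))
      ; ≡-transfer = λ x y → cong (place u k)
      }

    place-base : ∀ {u u′} k → u Preserves Fin._<_ ⟶ _<_ → u′ Preserves Fin._<_ ⟶ _<_ →
                 ∀ t → place u k (u t) ≡ place u′ k (u′ t)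
    place-base {u} {u′} k u↗ u′↗ t = cong c (Fin.fromℕ<-cong _ _
      (trans (position-base u k u↗ t) (sym (position-base u′ k u′↗ t))) _ _)

  transfers-resp : ∀ {f} {F : Set f} {p q q′ : F → I} → (∀ x → q x ≡ q′ x) → Transfers p q → Transfers p q′
  transfers-resp q≗q′ h = record
    { <-transfer = λ x y lt → subst₂ _<_ (q≗q′ x) (q≗q′ y) (<-transfer x y lt)
    ; ≡-transfer = λ x y eq → trans (sym (q≗q′ x)) (trans (≡-transfer x y eq) (q≗q′ y))
    }
    where open Transfers h

  -- One chain serves both families: `u` and `u′` land on the same entries `v`, while `k` lands on
  -- `l` or `l′` according to its position relative to each.
  amalgamate : Infinite I → ∀ {m n} {u u′ : Fin m → I} (k : Fin n → I) →
               u Preserves Fin._<_ ⟶ _<_ → u′ Preserves Fin._<_ ⟶ _<_ →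
               ∃ λ v → ∃ λ l → ∃ λ l′ → Transfers [ u , k ] [ v , l ] × Transfers [ u′ , k ] [ v , l′ ]
  amalgamate inf {m} {n} {u} {u′} k u↗ u′↗ with chain inf (suc m ℕ.* suc (suc n))
  ... | c , c↗ =
    place c c↗ u k ∘ u , place c c↗ u k ∘ k , place c c↗ u′ k ∘ k ,
    transfers-resp (λ { (inj₁ _) → refl ; (inj₂ _) → refl }) (transfers-place c c↗ u k) ,
    transfers-resp (λ { (inj₁ t) → place-base c c↗ k u′↗ u↗ t ; (inj₂ _) → refl }) (transfers-place c c↗ u′ k)

-- The order on the sum is strictly total for pointwise equality, which is equivalent to
-- propositional equality.
⊎-<-isSTO : ∀ {ℓ} {I J : Set ℓ} {_<₁_ : Rel I ℓ} {_<₂_ : Rel J ℓ} →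
            IsStrictTotalOrder _≡_ _<₁_ → IsStrictTotalOrder _≡_ _<₂_ →
            IsStrictTotalOrder _≡_ (_<₁_ ⊎-< _<₂_)
⊎-<-isSTO {_<₁_ = _<₁_} {_<₂_} sto₁ sto₂ = record
  { isStrictPartialOrder = record
    { isEquivalence = isEquivalence
    ; irrefl        = λ { refl → S.irrefl (≡⇒Pointwise-≡ refl) }
    ; trans         = S.trans
    ; <-resp-≈      = (λ { refl → id }) , (λ { refl → id })
    }
  ; compare = cmp
  }
  where
  module S = IsStrictTotalOrder (⊎-<-isStrictTotalOrder sto₁ sto₂)

  cmp : Trichotomous _≡_ (_<₁_ ⊎-< _<₂_)
  cmp x y with S.compare x y
  ... | tri< lt ≉ ≯ = tri< lt (≉ ∘ ≡⇒Pointwise-≡) ≯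
  ... | tri≈ ≮ eq ≯ = tri≈ ≮ (Pointwise-≡⇒≡ eq) ≯
  ... | tri> ≮ ≉ gt = tri> ≮ (≉ ∘ ≡⇒Pointwise-≡) gt

-- Indiscernibility along arbitrary finite families, and over kernel elements.

module _ {ℓ : Level} {L : Language ℓ} (M : Structure L) where
  open Language L
  open Structure M

  restrict-⊆ : ∀ {X : Set ℓ} {σ : X → Sort} (c : Tuple M σ) v → _⊆ₚ_ M (restrict M c v) (entries M c)
  restrict-⊆ c (x ∷ v) (here refl) = x , refl
  restrict-⊆ c (x ∷ v) (there y)   = restrict-⊆ c v y

  module _ {X I : Set ℓ} {σ : X → Sort} (a : I → Tuple M σ) where

    -- Two assignments with the same labels, one read through `p` and one through `q`. The context
    -- is an index, so concatenating and relabelling raise no equations between lists of sorts.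
    data Matches {f} {F : Set f} (p q : F → I) : ∀ {Γ} → All Carrier Γ → All Carrier Γ → Set (ℓ ⊔ f) where
      []  : Matches p q [] []
      _∷_ : ∀ {Γ} {ρ ρ′ : All Carrier Γ} ((t , x) : F × X) →
            Matches p q ρ ρ′ → Matches p q (a (p t) x ∷ ρ) (a (q t) x ∷ ρ′)

    matches-++ : ∀ {f} {F : Set f} {p q : F → I} {Γ Δ} {ρ ρ′ : All Carrier Γ} {e e′ : All Carrier Δ} →
                 Matches p q ρ ρ′ → Matches p q e e′ → Matches p q (++⁺ ρ e) (++⁺ ρ′ e′)
    matches-++ []       m′ = m′
    matches-++ (tx ∷ m) m′ = tx ∷ matches-++ m m′

    matches-restrict : ∀ {f} {F : Set f} {p q : F → I} {n} (r : Fin n → F) (v : List (Fin n × X)) →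
                       Matches p q (restrict M (select M a (p ∘ r)) v) (restrict M (select M a (q ∘ r)) v)
    matches-restrict r []            = []
    matches-restrict r ((t , x) ∷ v) = (r t , x) ∷ matches-restrict r v

    keys : ∀ {f} {F : Set f} {p q : F → I} {Γ} {ρ ρ′ : All Carrier Γ} → Matches p q ρ ρ′ → List F
    keys []            = []
    keys ((t , _) ∷ m) = t ∷ keys m

    matches-reindex : ∀ {f} {F : Set f} {p q : F → I} {n} (r : Fin n → F) {Γ} {ρ ρ′ : All Carrier Γ}
                      (m : Matches p q ρ ρ′) →
                      (∀ {t} → t ∈ keys m → ∃ λ s → p t ≡ p (r s) × q t ≡ q (r s)) →
                      Matches (p ∘ r) (q ∘ r) ρ ρ′
    matches-reindex r []            h = []
    matches-reindex {p = p} {q} r ((t , x) ∷ m) h with h (here refl)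
    ... | s , p≡ , q≡ =
      subst₂ (λ i j → Matches (p ∘ r) (q ∘ r) (a i x ∷ _) (a j x ∷ _)) (sym p≡) (sym q≡)
        ((s , x) ∷ matches-reindex r m (h ∘ there))

    -- A single equation between triples lets one match on `refl` replace the context and both
    -- assignments together.
    matches-labels : ∀ {n} {i j : Fin n → I} {Γ} {ρ ρ′ : All Carrier Γ} → Matches i j ρ ρ′ →
                     ∃ λ v → (Γ , ρ , ρ′) ≡
                       (map (σ ∘ proj₂) v , restrict M (select M a i) v , restrict M (select M a j) v)
    matches-labels []       = [] , refl
    matches-labels (tx ∷ m) with matches-labels m
    ... | v , refl = tx ∷ v , refl

    matches-self : ∀ {Γ} (e : All Carrier Γ) → _⊆ₚ_ M e (allEntries M a) → Matches id id e e
    matches-self []      h = []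
    matches-self (d ∷ e) h with h (here refl)
    ... | i , x , refl = (i , x) ∷ matches-self e (h ∘ there)

    module _ {_<_ : Rel I ℓ} (isSTO : IsStrictTotalOrder _≡_ _<_) where

      enumerate : ∀ {Γ} (e : All Carrier Γ) → _⊆ₚ_ M e (allEntries M a) →
                  ∃ λ n → ∃ λ (k : Fin n → I) → k Preserves Fin._<_ ⟶ _<_ ×
                  ∃ λ v → (Γ , e) ≡ (map (σ ∘ proj₂) v , restrict M (select M a k) v)
      enumerate e e⊆ with sort isSTO id (keys (matches-self e e⊆))
      ... | n , r , r↗ , cover with matches-labels
        (matches-reindex r (matches-self e e⊆) λ t∈ → let s , eq = cover t∈ in s , eq , eq)
      ... | v , refl = n , r , r↗ , v , refl

      -- Indiscernibility over one fixed finite list of parameters, the form in which kernel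
      -- elements are adjoined one by one.
      IndiscernibleAt : ∀ {Δ} → All Carrier Δ → Set ℓ
      IndiscernibleAt {Δ} b =
        ∀ {n} (i j : Fin n → I) → i Preserves Fin._<_ ⟶ _<_ → j Preserves Fin._<_ ⟶ _<_ →
        (v : List (Fin n × X)) (φ : Formula L (map (σ ∘ proj₂) v ++ Δ)) →
        Sat M (++⁺ (restrict M (select M a i) v) b) φ ⇔ Sat M (++⁺ (restrict M (select M a j) v) b) φ

      -- Sorting the labels by `p` gives representatives along which `p` increases. Then `q`
      -- increases along them by `<-transfer`, and `≡-transfer` handles the repeated values.
      transport : ∀ {Δ} {b : All Carrier Δ} → IndiscernibleAt b →
                  ∀ {f} {F : Set f} {p q : F → I} → Transfers isSTO p q →
                  ∀ {Γ} {ρ ρ′ : All Carrier Γ} → Matches p q ρ ρ′ →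
                  (φ : Formula L (Γ ++ Δ)) → Sat M (++⁺ ρ b) φ ⇔ Sat M (++⁺ ρ′ b) φ
      transport h {p = p} {q} T m φ with sort isSTO p (keys m)
      ... | n , r , pr↗ , cover with matches-labels
        (matches-reindex r m λ {t} t∈ → let s , eq = cover t∈ in s , eq , Transfers.≡-transfer T t (r s) eq)
      ... | v , refl = h (p ∘ r) (q ∘ r) pr↗ (λ s<t → Transfers.<-transfer T _ _ (pr↗ s<t)) v φ

      transport-∅ : IndiscernibleOver M ∅ _<_ a →
                    ∀ {f} {F : Set f} {p q : F → I} → Transfers isSTO p q →
                    ∀ {Γ} {ρ ρ′ : All Carrier Γ} → Matches p q ρ ρ′ →
                    (φ : Formula L Γ) → Sat M ρ φ ⇔ Sat M ρ′ φ
      transport-∅ h T {ρ = ρ} {ρ′} m φ =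
        ⇔-sym (sat-rename M (agree-++ˡ ρ′ []) φ)
          ⇔-∘ (transport (λ i j i↗ j↗ v → h i j i↗ j↗ v [] (λ ())) T m (rename _ φ)
          ⇔-∘ sat-rename M (agree-++ˡ ρ []) φ)

    module _ (_<_ : Rel I ℓ) where

      -- That `ψ` defines `d` from a tuple is itself a formula in the tuple with parameter `d`, so
      -- indiscernibility over `d` carries it from `k` to `k′`.
      definition-shift : ∀ {s} {d : Carrier s} → IndiscernibleOver M ｛ s , d ｝ _<_ a →
                         ∀ {n} {k k′ : Fin n → I} → k Preserves Fin._<_ ⟶ _<_ → k′ Preserves Fin._<_ ⟶ _<_ →
                         ∀ v (ψ : Formula L (s ∷ map (σ ∘ proj₂) v)) →
                         Defines M ψ (restrict M (select M a k) v) d →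
                         Defines M ψ (restrict M (select M a k′) v) d
      definition-shift {s} {d} h {k = k} {k′} k↗ k′↗ v ψ =
        to (sat-definesᶠ M ψ) ∘ from (sat-rename M (rotate (restrict M (select M a k′) v)) (definesᶠ M ψ))
        ∘ to (h k k′ k↗ k′↗ v (d ∷ []) (λ { (here refl) → refl }) (rename _ (definesᶠ M ψ)))
        ∘ to (sat-rename M (rotate (restrict M (select M a k) v)) (definesᶠ M ψ)) ∘ from (sat-definesᶠ M ψ)
        where
        rotate : ∀ {Θ} (e : All Carrier Θ) → Agree (∈-++⁺ʳ Θ (here refl) ▹ ∈-++⁺ˡ) (d ∷ e) (++⁺ e (d ∷ []))
        rotate e = agree-▹ (lookup≡ (agree-++ʳ e (d ∷ [])) (here refl)) (agree-++ˡ e (d ∷ []))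

    module _ {_<_ : Rel I ℓ} (isSTO : IsStrictTotalOrder _≡_ _<_) (inf : Infinite I) where

      indiscernibleAt-∷ : ∀ {Δ} {b : All Carrier Δ} {s} {d : Carrier s} → IndiscernibleAt isSTO b →
                          dcl M (allEntries M a) (s , d) → IndiscernibleOver M ｛ s , d ｝ _<_ a →
                          IndiscernibleAt isSTO (d ∷ b)
      indiscernibleAt-∷ {b = b} {d = d} hb (_ , e , e⊆ , ψ , def) hd i j i↗ j↗ v φ
        with enumerate isSTO e e⊆ | eliminate M ψ φ
      ... | n , k , k↗ , w , refl | φ′ , φ⇔φ′
        with amalgamate isSTO inf k i↗ j↗
      ... | u , l , l′ , T , T′ = ⇔-sym (shift T′) ⇔-∘ shift T
        where
        shift : ∀ {i l} → Transfers isSTO [ i , k ] [ u , l ] →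
                Sat M (++⁺ (restrict M (select M a i) v) (d ∷ b)) φ ⇔
                Sat M (++⁺ (restrict M (select M a u) v) (d ∷ b)) φ
        shift T =
          -- `l` increases because it has the order pattern of `k`; hence `ψ` defines the same `d`
          -- along `l`, and there `φ′` turns back into `φ`.
          ⇔-sym (φ⇔φ′ (definition-shift _<_ hd k↗ (Transfers.<-transfer T (inj₂ _) (inj₂ _) ∘ k↗) w ψ def))
            ⇔-∘ (transport isSTO hb T (matches-++ (matches-restrict inj₁ v) (matches-restrict inj₂ w)) φ′
            ⇔-∘ φ⇔φ′ def)

      indiscernibleOver-kernel : ∀ {b} {B : Pred (Element M) b} →
                                 (∀ {x} → B x → dcl M (allEntries M a) x × IndiscernibleOver M ｛ x ｝ _<_ a) →
                                 IndiscernibleOver M ∅ _<_ a → IndiscernibleOver M B _<_ a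
      indiscernibleOver-kernel {B = B} B⊆ker h i j i↗ j↗ v b b⊆B = at b b⊆B i j i↗ j↗ v
        where
        at : ∀ {Δ} (b : All Carrier Δ) → _⊆ₚ_ M b B → IndiscernibleAt isSTO b
        at []      _   i j i↗ j↗ v = h i j i↗ j↗ v [] (λ ())
        at (d ∷ b) b⊆B = let dcl-d , hd = B⊆ker (b⊆B (here refl)) in
          indiscernibleAt-∷ (at b (b⊆B ∘ there)) dcl-d hd

  -- Kernels and two separated parts of one indiscernible sequence.

  commonᶠ : ∀ {Θ s} → Formula L (s ∷ Θ) → Formula L (Θ ++ Θ)
  commonᶠ {Θ} {s} ψ =
    ∃ᶠ s (rename (here refl ▹ there ∘ ∈-++⁺ˡ) ψ ∧ᶠ rename (here refl ▹ there ∘ ∈-++⁺ʳ Θ) (definesᶠ M ψ))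

  -- Uniqueness is part of the formula for `e′` only: `e` will be moved to a tuple over which `ψ` is
  -- known to have one solution.
  sat-commonᶠ : ∀ {Θ s} (ψ : Formula L (s ∷ Θ)) {e e′ : All Carrier Θ} →
                Sat M (++⁺ e e′) (commonᶠ ψ) ⇔ (∃ λ d → Sat M (d ∷ e) ψ × Defines M ψ e′ d)
  sat-commonᶠ ψ {e} {e′} = mk⇔
    (λ (d , h , h′) → d , from (sat-rename M (agree-lift (agree-++ˡ e e′)) ψ) h
      , to (sat-definesᶠ M ψ) (from (sat-rename M (agree-lift (agree-++ʳ e e′)) (definesᶠ M ψ)) h′))
    (λ (d , h , h′) → d , to (sat-rename M (agree-lift (agree-++ˡ e e′)) ψ) h
      , to (sat-rename M (agree-lift (agree-++ʳ e e′)) (definesᶠ M ψ)) (from (sat-definesᶠ M ψ) h′))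

  -- Both orders of concatenation are treated at once: `α` and `β` embed the two index orders in
  -- `K`, one image lying wholly below the other.
  module _ {X I J K : Set ℓ} {σ : X → Sort} {_<₁_ : Rel I ℓ} {_<₂_ : Rel J ℓ} {_<_ : Rel K ℓ}
           (isSTO₁ : IsStrictTotalOrder _≡_ _<₁_) (isSTO₂ : IsStrictTotalOrder _≡_ _<₂_)
           (isSTO : IsStrictTotalOrder _≡_ _<_)
           {α : I → K} (α↗ : α Preserves _<₁_ ⟶ _<_) {β : J → K} (β↗ : β Preserves _<₂_ ⟶ _<_)
           (separated : (∀ i j → α i < β j) ⊎ (∀ i j → β j < α i))
           (c : K → Tuple M σ) (indisc : IndiscernibleOver M ∅ _<_ c) where

    -- All indices from `β` lie on the same side of all indices from `α`, so replacing `i` by `j`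
    -- keeps the order pattern relative to the parameters.
    indiscernibleOver-separated : IndiscernibleOver M (allEntries M (c ∘ β)) _<₁_ (c ∘ α)
    indiscernibleOver-separated i j i↗ j↗ v e e⊆ φ with enumerate (c ∘ β) isSTO₂ e e⊆
    ... | n , k , k↗ , w , refl =
      transport-∅ c isSTO indisc
        (transfers-blocks isSTO (α↗ ∘ i↗) (α↗ ∘ j↗) (β↗ ∘ k↗) (β↗ ∘ k↗) λ s t →
          Sum.map (λ lt → lt (i s) (k t) , lt (j s) (k t)) (λ gt → gt (i s) (k t) , gt (j s) (k t)) separated)
        (matches-++ c (matches-restrict c inj₁ v) (matches-restrict c inj₂ w)) φ

    module _ (inf₁ : Infinite I) (inf₂ : Infinite J) where

      -- A chain of length `n + n` is cut into halves. The lower half is `u` exactly when `α` lies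
      -- below `β`, so `u` stands to `u′` as `k` stands to `j`.
      two-blocks : ∀ n → ∃ λ (u : Fin n → I) → ∃ λ (u′ : Fin n → I) →
                   u Preserves Fin._<_ ⟶ _<₁_ × u′ Preserves Fin._<_ ⟶ _<₁_ ×
                   (∀ (k : Fin n → I) (j : Fin n → J) s t →
                     (α (u s) < α (u′ t) × α (k s) < β (j t)) ⊎ (α (u′ t) < α (u s) × β (j t) < α (k s)))
      two-blocks n with chain isSTO₁ inf₁ (n ℕ.+ n)
      ... | r , r↗ =
        [ (λ lt → r ∘ (_↑ˡ n) , r ∘ (n ↑ʳ_) , (λ {_} {_} → lower↗) , (λ {_} {_} → upper↗) ,
                  λ _ _ s t → inj₁ (α↗ (lower<upper s t) , lt _ _))
        , (λ gt → r ∘ (n ↑ʳ_) , r ∘ (_↑ˡ n) , (λ {_} {_} → upper↗) , (λ {_} {_} → lower↗) ,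
                  λ _ _ s t → inj₂ (α↗ (lower<upper t s) , gt _ _))
        ]′ separated
        where
        lower↗ : (r ∘ (_↑ˡ n)) Preserves Fin._<_ ⟶ _<₁_
        lower↗ {s} {t} lt = r↗ (subst₂ ℕ._<_ (sym (Fin.toℕ-↑ˡ s n)) (sym (Fin.toℕ-↑ˡ t n)) lt)

        upper↗ : (r ∘ (n ↑ʳ_)) Preserves Fin._<_ ⟶ _<₁_
        upper↗ {s} {t} lt =
          r↗ (subst₂ ℕ._<_ (sym (Fin.toℕ-↑ʳ n s)) (sym (Fin.toℕ-↑ʳ n t)) (ℕ.+-monoʳ-< n lt))

        lower<upper : ∀ s t → r (s ↑ˡ n) <₁ r (n ↑ʳ t)
        lower<upper s t = r↗ (subst₂ ℕ._<_ (sym (Fin.toℕ-↑ˡ s n)) (sym (Fin.toℕ-↑ʳ n t))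
                               (ℕ.<-≤-trans (Fin.toℕ<n s) (ℕ.m≤m+n n _)))

      kernel⊆dcl : ∀ {x} → dcl M (allEntries M (c ∘ α)) x → IndiscernibleOver M ｛ x ｝ _<₁_ (c ∘ α) →
                   dcl M (allEntries M (c ∘ β)) x
      kernel⊆dcl {_ , d} (_ , e , e⊆ , ψ , def) h with enumerate (c ∘ α) isSTO₁ e e⊆
      ... | n , k , k↗ , w , refl with two-blocks n | chain isSTO₂ inf₂ n
      ... | u , u′ , u↗ , u′↗ , cross | j , j↗
        -- The block `u` moves to `k` and the block `u′` moves to `j`; before the move `d` itself is
        -- the common value.
        with to (sat-commonᶠ ψ) (to (transport-∅ c isSTO indisc
               (transfers-blocks isSTO (α↗ ∘ u↗) (α↗ ∘ k↗) (α↗ ∘ u′↗) (β↗ ∘ j↗) (cross k j))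
               (matches-++ c (matches-restrict c inj₁ w) (matches-restrict c inj₂ w)) (commonᶠ ψ))
             (from (sat-commonᶠ ψ) (d , proj₁ (definition-shift (c ∘ α) _<₁_ h k↗ u↗ w ψ def)
                                      , definition-shift (c ∘ α) _<₁_ h k↗ u′↗ w ψ def)))
      -- The value may change in the move, but over `k` the only solution of `ψ` is `d`.
      ... | d′ , sat , def′ with proj₂ def d′ sat
      ... | refl = _ , restrict M (select M (c ∘ β) j) w ,
        (λ y → let (t , x) , eq = restrict-⊆ (select M (c ∘ β) j) w y in j t , x , eq) , ψ , def′

      kernel-separated :
        (λ x → dcl M (allEntries M (c ∘ α)) x × IndiscernibleOver M ｛ x ｝ _<₁_ (c ∘ α)) ≐
        (dcl M (allEntries M (c ∘ α)) ∩ dcl M (allEntries M (c ∘ β)))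
      kernel-separated =
        (λ (x∈dcl , h) → x∈dcl , kernel⊆dcl x∈dcl h) ,
        (λ {x} (x∈dclα , x∈dclβ) → x∈dclα ,
          indiscernibleOver-dcl M (allEntries M (c ∘ β)) ｛ x ｝ (λ { refl → x∈dclβ }) _<₁_ (c ∘ α)
            indiscernibleOver-separated)

-- The four statements about kernels.

module _ {ℓ : Level} {L : Language ℓ} {κ : Set ℓ} {M : Structure L}
         {X : Set ℓ} {σ : X → Language.Sort L} where
  open IndiscernibleSequence

  ker-collinear : (A B : IndiscernibleSequence κ M σ) → CleanlyCollinear A B →
                  ker A ≐ (dcl M (terms A) ∩ dcl M (terms B))
  ker-collinear A B (inj₁ h) =
    kernel-separated M (isStrictTotalOrder A) (isStrictTotalOrder B)
      (⊎-<-isSTO (isStrictTotalOrder A) (isStrictTotalOrder B))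
      ₁∼₁ ₂∼₂ (inj₁ λ _ _ → ₁∼₂) [ tuple A , tuple B ] h (infinite A) (infinite B)
  ker-collinear A B (inj₂ h) =
    kernel-separated M (isStrictTotalOrder A) (isStrictTotalOrder B)
      (⊎-<-isSTO (isStrictTotalOrder B) (isStrictTotalOrder A))
      ₂∼₂ ₁∼₁ (inj₂ λ _ _ → ₁∼₂) [ tuple B , tuple A ] h (infinite A) (infinite B)

  -- Clean collinearity is symmetric, and so is the intersection that describes the kernel; a chain
  -- of collinear sequences is followed link by link.
  ker-invariant : {A B : IndiscernibleSequence κ M σ} → A ≈ B → ker A ≐ ker B
  ker-invariant {A} {B} (single h) =
    ≐-trans (ker-collinear A B h) (≐-trans (swap , swap) (≐-sym (ker-collinear B A (Sum.swap h))))
  ker-invariant {A} (_∷_ {y = C} h hs) = ≐-trans (ker-invariant {A} {C} (single h)) (ker-invariant hs)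

  indiscernibleOver-ker : (A : IndiscernibleSequence κ M σ) → SequenceIndiscernibleOver A (ker A)
  indiscernibleOver-ker A =
    indiscernibleOver-kernel M (tuple A) (isStrictTotalOrder A) (infinite A) id (indiscernible A)

  -- Indiscernibility over the whole kernel passes to its definable closure, hence to each single
  -- element of that closure.
  ker-dcl : (A : IndiscernibleSequence κ M σ) → ker A ≐ dcl M (ker A)
  ker-dcl A = ⊆-dcl M , λ {x} h →
    dcl-trans M (ker A) (terms A) proj₁ h ,
    indiscernibleOver-dcl M (ker A) ｛ x ｝ (λ { refl → h }) (_<_ A) (tuple A) (indiscernibleOver-ker A)

theorem3p8 : {ℓ : Level} (L : Language ℓ) (T : Theory L) → Complete T → Consistent T →
    (κ : Set ℓ) (M : Structure L) → IsBigSaturatedModel κ T M →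
    (X : Set ℓ) → Small κ X → (σ : X → Language.Sort L) →
    (A B : IndiscernibleSequence κ M σ) →
    (A ≈ B → ker A ≐ ker B)
    × (CleanlyCollinear A B → ker A ≐ (dcl M (terms A) ∩ dcl M (terms B)))
    × (ker A ≐ dcl M (ker A))
    × SequenceIndiscernibleOver A (ker A)
theorem3p8 L T _ _ κ M _ X _ σ A B =
  ker-invariant , ker-collinear A B , ker-dcl A , indiscernibleOver-ker A
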